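{- There exists a finite colouring of $\mathbb{N}^{(2)}$ such that there does not exist a sequence of natural numbers $(y_k)_{k\ge1}$ for which all pairs of the form $(y_1+y_{k_1}+y_{k_2}+\cdots+y_{k_t},\ y_1+y_2+y_3+\cdots+y_{k_{t+1}})$, for all $t\ge0$ and all $2\le k_1<k_2<\cdots<k_{t+1}$, have the same colour.
   Context: $\mathbb{N}^{(2)}$ denotes the set of pairs $(a,b)$ of natural numbers with $a<b$; natural numbers here are positive integers, so each pair above has first coordinate strictly smaller than the second. Equivalently, the forbidden configuration is: all pairs $(\sum_{i\in S}y_i,\ \sum_{i=1}^{m}y_i)$ with $S$ a finite set of indices containing $1$ and $m>\max S$ have the same colour. -}

module Defs where

open import Data.Nat using (ℕ; zero; suc; _+_; _≤_; _<_)
open import Data.Fin using (Fin)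
open import Data.List using (List; map)
open import Data.Nat.ListAction using (sum)
open import Data.List.Relation.Unary.All using (All)
open import Data.List.Relation.Unary.Linked using (Linked)
open import Data.Product using (Σ; _×_)
open import Relation.Binary.PropositionalEquality using (_≡_)

-- Sequences (y_k)_{k ≥ 1} are represented as functions y : ℕ → ℕ, where
-- y k is y_k for k ≥ 1; the value y 0 is never used.

sumTo : (ℕ → ℕ) → ℕ → ℕ
sumTo y zero    = 0
sumTo y (suc m) = sumTo y m + y (suc m)

-- A sequence of natural (= positive) numbers.
PositiveSeq : (ℕ → ℕ) → Set
PositiveSeq y = ∀ k → 1 ≤ k → 1 ≤ y k

-- Index data: ks = [k_1, ..., k_t] strictly increasing, all ≥ 2, and
-- m = k_{t+1} > every element of ks, m ≥ 2.
ValidIndices : List ℕ → ℕ → Set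
ValidIndices ks m = Linked _<_ ks × All (2 ≤_) ks × All (_< m) ks × 2 ≤ m

Monochromatic : ∀ {r} → (ℕ → ℕ → Fin r) → (ℕ → ℕ) → Fin r → Set
Monochromatic c y κ =
  ∀ (ks : List ℕ) (m : ℕ) → ValidIndices ks m →
  c (y 1 + sum (map y ks)) (sumTo y m) ≡ κ

{-# OPTIONS --safe #-}
-- Read the binary digits of a and of d = b − a from the least significant end. A digit pair (1,0) is a
-- letter A, (0,1) is a letter D, equal digits are ignored. The colour of (a , b) is the number of
-- alternations between A and D, mod 4, where the word is taken to start with an A.
--
-- Let P_m = y_1 + … + y_m. For j < k < i < l the forbidden configuration contains (P_j , P_l), (P_k , P_l),
-- (P_i , P_l) and (P_j + P_i − P_k , P_l). By compactness the P_m have a 2-adic cluster point L. If L is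
-- not a natural number, choose j, k, i, l so that P_k, P_i, P_l agree with L far beyond the length of P_j,
-- and P_i, P_l far beyond the length of P_k. Then the word of the fourth pair is made of the words of the
-- first three, the second with A and D exchanged. Each word goes from A to D, so each contributes
-- the same odd number κ of alternations, and 3κ ≡ κ (mod 4) is impossible. If L is a
-- natural number, then P_m = L + 2^u (1 + 2 (ε + 2 r)) for infinitely many m, with u unbounded, and for
-- a digit ε that recurs the same count works, the borrows changing the total by a multiple of 4.
module Submission where

open import Defs
open import Data.Bool using (Bool; true; false; not)
open import Data.Empty using (⊥; ⊥-elim)
open import Data.Fin using (Fin)
open import Data.Fin.Patterns using (0F; 1F; 2F; 3F)
open import Data.List using (List; []; _∷_; map; _++_)
open import Data.List.Properties using (map-++; ++-identityʳ)
open import Data.List.Relation.Unary.All as All using (All; []; _∷_)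
import Data.List.Relation.Unary.All.Properties as All
open import Data.List.Relation.Unary.Linked using (Linked; []; [-]; _∷_)
open import Data.Nat
open import Data.Nat.ListAction using (sum)
open import Data.Nat.ListAction.Properties using (sum-++)
open import Data.Nat.Properties
open import Data.Nat.Tactic.RingSolver using (solve-∀)
open import Data.Product using (Σ; _×_; _,_; ∃)
open import Data.Sum using (_⊎_; inj₁; inj₂)
open import Function using (_∘_)
open import Relation.Nullary using (¬_)
open import Relation.Binary.PropositionalEquality

-- Counting alternations with a four-state automaton.

-- A state is the number of alternations read so far, mod 4: even states are those whose last letter is A.
toA toD rot : Fin 4 → Fin 4
toA 0F = 0F
toA 1F = 2F
toA 2F = 2F
toA 3F = 0F
toD 0F = 1F
toD 1F = 1F
toD 2F = 3F
toD 3F = 3F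
rot 0F = 1F
rot 1F = 2F
rot 2F = 3F
rot 3F = 0F

step : Fin 4 → Bool → Bool → Fin 4
step s true  false = toA s
step s false true  = toD s
step s true  true  = s
step s false false = s

bit : ℕ → Bool
bit 0             = false
bit 1             = true
bit (suc (suc n)) = bit n

-- Opaque, so that unification treats run as injective.
opaque
  run : ℕ → Fin 4 → ℕ → ℕ → Fin 4
  run zero    s a d = s
  run (suc n) s a d = run n (step s (bit a) (bit d)) ⌊ a /2⌋ ⌊ d /2⌋

toD-rot : ∀ s → toD (rot s) ≡ rot (toA s)
toD-rot 0F = refl
toD-rot 1F = refl
toD-rot 2F = refl
toD-rot 3F = refl

toA-rot : ∀ s → toA (rot s) ≡ rot (toD s)
toA-rot 0F = refl
toA-rot 1F = refl
toA-rot 2F = refl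
toA-rot 3F = refl

step-swap : ∀ s x y → step (rot s) y x ≡ rot (step s x y)
step-swap s true  true  = refl
step-swap s true  false = toD-rot s
step-swap s false true  = toA-rot s
step-swap s false false = refl

opaque
  unfolding run

  -- The parity of a state records the last letter, so exchanging A and D while adding one to the
  -- state preserves every alternation.
  run-swap : ∀ n s a d → run n (rot s) d a ≡ rot (run n s a d)
  run-swap zero    s a d = refl
  run-swap (suc n) s a d rewrite step-swap s (bit a) (bit d) =
    run-swap n (step s (bit a) (bit d)) ⌊ a /2⌋ ⌊ d /2⌋

run-rot² : ∀ n s a d → run n (rot (rot s)) a d ≡ rot (rot (run n s a d))
run-rot² n s a d = trans (run-swap n (rot s) d a) (cong rot (run-swap n s a d))

data OddState : Fin 4 → Set where
  one   : OddState 1F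
  three : OddState 3F

toD-odd : ∀ s → OddState (toD s)
toD-odd 0F = one
toD-odd 1F = one
toD-odd 2F = three
toD-odd 3F = three

toD-fixed : ∀ {s} → OddState s → toD s ≡ s
toD-fixed one   = refl
toD-fixed three = refl

opaque
  unfolding run

  -- In an odd state the last letter was D, and `a` = 0 yields only further letters D.
  run-odd : ∀ n {s} d → OddState s → run n s 0 d ≡ s
  run-odd zero    d o = refl
  run-odd (suc n) d o with bit d
  ... | true  rewrite toD-fixed o = run-odd n ⌊ d /2⌋ o
  ... | false = run-odd n ⌊ d /2⌋ o

  run-zero : ∀ n a → run n 0F a 0 ≡ 0F
  run-zero zero    a = refl
  run-zero (suc n) a with bit a
  ... | true  = run-zero n ⌊ a /2⌋
  ... | false = run-zero n ⌊ a /2⌋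

-- Concatenation of blocks of binary digits.

double-suc : ∀ a x → a + 2 * suc x ≡ suc (suc (a + 2 * x))
double-suc = solve-∀

bit-+ : ∀ a x → bit (a + 2 * x) ≡ bit a
bit-+ a zero    = cong bit (+-identityʳ a)
bit-+ a (suc x) = trans (cong bit (double-suc a x)) (bit-+ a x)

half-+ : ∀ a x → ⌊ a + 2 * x /2⌋ ≡ ⌊ a /2⌋ + x
half-+ a zero    = trans (cong ⌊_/2⌋ (+-identityʳ a)) (sym (+-identityʳ _))
half-+ a (suc x) = trans (cong ⌊_/2⌋ (double-suc a x))
  (trans (cong suc (half-+ a x)) (sym (+-suc _ x)))

half-< : ∀ a t → a < 2 * t → ⌊ a /2⌋ < t
half-< 0             (suc t) _ = z<s
half-< 1             (suc t) _ = z<s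
half-< (suc (suc a)) (suc t) p =
  s<s (half-< a t (s<s⁻¹ (s<s⁻¹ (subst (suc (suc a) <_) (double-suc 0 t) p))))

bit-half : ∀ n → (bit n ≡ false × n ≡ 2 * ⌊ n /2⌋) ⊎ (bit n ≡ true × n ≡ suc (2 * ⌊ n /2⌋))
bit-half 0 = inj₁ (refl , refl)
bit-half 1 = inj₂ (refl , refl)
bit-half (suc (suc n)) with bit-half n
... | inj₁ (b , e) = inj₁ (b , trans (cong (suc ∘ suc) e) (sym (double-suc 0 _)))
... | inj₂ (b , e) = inj₂ (b , trans (cong (suc ∘ suc) e) (sym (cong suc (double-suc 0 _))))

opaque
  unfolding run

  run-++ : ∀ n m {T s a d a′ d′} → 2 ^ n ≡ T → a < T → d < T →
           run (n + m) s (a + T * a′) (d + T * d′) ≡ run m (run n s a d) a′ d′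
  run-++ zero m {s = s} {zero} {zero} {a′} {d′} refl p q =
    cong₂ (run m s) (+-identityʳ a′) (+-identityʳ d′)
  run-++ zero m {a = suc _} refl (s≤s ()) q
  run-++ zero m {d = suc _} refl p (s≤s ())
  run-++ (suc n) m {s = s} {a} {d} {a′} {d′} refl p q
    rewrite *-assoc 2 (2 ^ n) a′ | *-assoc 2 (2 ^ n) d′
          | bit-+ a (2 ^ n * a′) | bit-+ d (2 ^ n * d′)
          | half-+ a (2 ^ n * a′) | half-+ d (2 ^ n * d′)
    = run-++ n m refl (half-< a (2 ^ n) p) (half-< d (2 ^ n) q)

  run-0d : ∀ n s d → 0 < d → d < 2 ^ n → OddState (run n s 0 d)
  run-0d zero    s (suc d) _ (s≤s ())
  run-0d (suc n) s d p q with bit d | ⌊ d /2⌋ | bit-half d | half-< d (2 ^ n) q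
  ... | true  | h | _ | _ = subst OddState (sym (run-odd n h (toD-odd s))) (toD-odd s)
  ... | false | zero | inj₁ (_ , refl) | _ = ⊥-elim (<-irrefl refl p)
  ... | false | suc h | _ | h< = run-0d n s (suc h) z<s h<

  -- From place `m` on only `d` has ones, and it has at least one there, so the last letter is D.
  run-top : ∀ n m s a d → a < 2 ^ m → 2 ^ m ≤ d → d < 2 ^ n → OddState (run n s a d)
  run-top n zero s zero d _ p q = run-0d n s d p q
  run-top n zero s (suc _) d (s≤s ()) p q
  run-top zero (suc m) s a d r p q = ⊥-elim (<-irrefl refl (<-≤-trans q (≤-trans (m^n>0 2 (suc m)) p)))
  run-top (suc n) (suc m) s a d r p q =
    run-top n m _ ⌊ a /2⌋ ⌊ d /2⌋ (half-< a _ r) half-≥ (half-< d _ q)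
    where
    half-≥ : 2 ^ m ≤ ⌊ d /2⌋
    half-≥ = subst (_≤ ⌊ d /2⌋) (half-+ 0 (2 ^ m)) (⌊n/2⌋-mono p)

-- The colouring, and the four pairs when no borrow occurs.

-- Reading `b` digits exhausts every number up to `b`, since b < 2^b.
colour : ℕ → ℕ → Fin 4
colour a b = run b 0F a (b ∸ a)


colour-run : ∀ {a d b} n → b ≡ n → a + d ≡ b → colour a b ≡ run n 0F a d
colour-run {a} {d} n refl refl rewrite m+n∸m≡n a d = refl

-- Entered in the odd state κ, the swapped block adds κ and ends in the even state 2κ; the last word
-- adds κ again, and 3κ differs from κ mod 4.
swapped-block-≢ : ∀ {κ} → OddState κ → ∀ n m q f r g →
               run n 0F q f ≡ κ → run m 0F r g ≡ κ → run m (run n κ f q) r g ≢ κ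
swapped-block-≢ one n m q f r g eq er
  rewrite run-swap n 0F q f | eq | run-rot² m 0F r g | er = λ ()
swapped-block-≢ three n m q f r g eq er
  rewrite run-swap n 2F q f | run-rot² n 0F q f | eq | run-rot² m 0F r g | er = λ ()

nested-sum₂ : ∀ p e T x y → (p + T * x) + (e + T * y) ≡ (p + e) + T * (x + y)
nested-sum₂ = solve-∀

pad : ∀ p T q S → p + T * q ≡ p + T * (q + S * 0)
pad = solve-∀

pad₀ : ∀ p T → p ≡ p + T * 0
pad₀ = solve-∀

run-from : ∀ n m {T s σ a d a′ d′} → 2 ^ n ≡ T → a < T → d < T → run n s a d ≡ σ →
           run (n + m) s (a + T * a′) (d + T * d′) ≡ run m σ a′ d′
run-from n m nT a< d< refl = run-++ n m nT a< d<

run-skip : ∀ n m {T a a′ d′} → 2 ^ n ≡ T → a < T →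
           run (n + m) 0F (a + T * a′) (T * d′) ≡ run m 0F a′ d′
run-skip n m {a = a} nT a< = run-from n m nT a< (≤-<-trans z≤n a<) (run-zero n a)

run-final : ∀ n m {T s a d d′} → 2 ^ n ≡ T → a < T → d < T → OddState (run n s a d) →
            run (n + m) s (a + T * 0) (d + T * d′) ≡ run n s a d
run-final n m nT a< d< odd = trans (run-++ n m nT a< d<) (run-odd m _ odd)

-- The four colours are those of (P_j , P_l), (P_k , P_l), (P_i , P_l), (P_j + P_i − P_k , P_l), where p = P_j
-- and p + e, q + f are successive blocks of digits of the cluster point.
no-borrow : ∀ n m {T S} p e q f r g {κ} → 2 ^ n ≡ T → 2 ^ m ≡ S → p + e < T → q + f < S →
  let b = (p + e) + T * ((q + f) + S * (r + g)) in n + m ≤ b →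
  OddState (run n 0F p e) → OddState (run m 0F q f) →
  colour p b ≡ κ →
  colour ((p + e) + T * q) b ≡ κ →
  colour ((p + e) + T * ((q + f) + S * r)) b ≡ κ →
  colour (p + T * (f + S * r)) b ≢ κ
no-borrow n m {T} {S} p e q f r g {κ} nT mS pe< qf< nm≤ odd₁ odd₂ cj ck ci cmix =
  swapped-block-≢ (subst OddState κ₁ odd₁) m t q f r g κ₂ κ₃ κ₄
  where
  b = (p + e) + T * ((q + f) + S * (r + g))
  t = b ∸ (n + m)
  b≡ : b ≡ n + (m + t)
  b≡ = trans (sym (m+[n∸m]≡n nm≤)) (+-assoc n m t)
  p< = ≤-<-trans (m≤m+n p e) pe<
  e< = ≤-<-trans (m≤n+m e p) pe<
  q< = ≤-<-trans (m≤m+n q f) qf<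
  f< = ≤-<-trans (m≤n+m f q) qf<
  decode : ∀ {a} x y → a ≡ x → x + y ≡ b → colour a b ≡ κ → run (n + (m + t)) 0F x y ≡ κ
  decode x y refl xy c = trans (sym (colour-run (n + (m + t)) b≡ xy)) c
  κ₁ : run n 0F p e ≡ κ
  -- P_j has no digits above the first block and its word there ends in D, so the later letters D
  -- add nothing.
  κ₁ = trans (sym (run-final n (m + t) nT p< e< odd₁))
    (decode (p + T * 0) (e + T * ((q + f) + S * (r + g))) (pad₀ p T)
            (nested-sum₂ p e T 0 _) cj)
  κ₂ : run m 0F q f ≡ κ
  -- The difference vanishes on the low block; the letters A found there leave the starting state
  -- fixed.
  κ₂ = trans (sym (trans (run-skip n (m + t) nT pe<) (run-final m t mS q< f< odd₂)))
    (decode ((p + e) + T * (q + S * 0)) (T * (f + S * (r + g))) (pad (p + e) T q S)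
            (lemma (p + e) T q f S (r + g)) ck)
    where
    lemma : ∀ c T q f S x → (c + T * (q + S * 0)) + T * (f + S * x) ≡ c + T * ((q + f) + S * x)
    lemma = solve-∀
  κ₃ : run t 0F r g ≡ κ
  κ₃ = trans (sym (trans (run-skip n (m + t) nT pe<) (run-skip m t mS qf<)))
    (decode ((p + e) + T * ((q + f) + S * r)) (T * (S * g)) refl
            (lemma (p + e) T (q + f) S r g) ci)
    where
    lemma : ∀ c T c′ S r g → (c + T * (c′ + S * r)) + T * (S * g) ≡ c + T * (c′ + S * (r + g))
    lemma = solve-∀
  κ₄ : run t (run m κ f q) r g ≡ κ
  -- Here `q` and `f` have changed sides, which exchanges A and D in the middle word.
  κ₄ = trans (sym (trans (run-from n (m + t) nT p< e< κ₁) (run-++ m t mS f< q<)))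
    (decode (p + T * (f + S * r)) (e + T * (q + S * g)) refl
            (lemma p e T q f S r g) cmix)
    where
    lemma : ∀ p e T q f S r g →
      (p + T * (f + S * r)) + (e + T * (q + S * g)) ≡ (p + e) + T * ((q + f) + S * (r + g))
    lemma = solve-∀

-- The four pairs when borrows occur.

digit : Bool → ℕ
digit false = 0
digit true  = 1

withLowBits : Bool → ℕ → ℕ
withLowBits ε r = 1 + 2 * (digit ε + 2 * r)

bit-digit : ∀ ε → bit (digit ε) ≡ ε
bit-digit false = refl
bit-digit true  = refl

digit<2 : ∀ ε → digit ε < 2
digit<2 false = z<s
digit<2 true  = s<s z<s

opaque
  unfolding run

  run-digit : ∀ {m s} x y a d →
    run (suc m) s (digit x + 2 * a) (digit y + 2 * d) ≡ run m (step s x y) a d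
  run-digit {m} {s} x y a d = trans (run-++ 1 m refl (digit<2 x) (digit<2 y))
    (cong₂ (λ u v → run m (step s u v) a d) (bit-digit x) (bit-digit y))

-- The borrows insert an A before the swapped block and a D after it. For `ε` = `false` each merges
-- with the equal letter that follows; for `ε` = `true` each adds two alternations. Either way the
-- final state is 3κ mod 4.
swapped-block-borrow-≢ : ∀ {κ} → OddState κ → ∀ ε n m q f r g →
  run n (step 0F ε (not ε)) q f ≡ κ → run m (step 0F ε (not ε)) r g ≡ κ →
  run m (step (step (run n (step (step κ true false) (not ε) ε) f q) false true) ε (not ε)) r g ≢ κ
swapped-block-borrow-≢ one true n m q f r g eq er
  rewrite run-swap n 2F q f | run-rot² n 0F q f | eq | run-rot² m 0F r g | er = λ ()
swapped-block-borrow-≢ one false n m q f r g eq er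
  rewrite run-swap n 1F q f | eq | run-rot² m 1F r g | er = λ ()
swapped-block-borrow-≢ three true n m q f r g eq er
  rewrite run-swap n 0F q f | eq | run-rot² m 0F r g | er = λ ()
swapped-block-borrow-≢ three false n m q f r g eq er
  rewrite run-swap n 3F q f | run-rot² n 1F q f | eq | run-rot² m 1F r g | er = λ ()

-- The low block overflows by exactly `T`, which supplies the unit missing from `x + y`.
carry-sum : ∀ A e T L {B} x y → A + e ≡ L + T → suc (x + y) ≡ B →
            (A + T * x) + (e + T * y) ≡ L + T * B
carry-sum A e T L x y Ae refl = trans (nested-sum₂ A e T x y)
  (trans (cong (_+ T * (x + y)) Ae) (trans (+-assoc L T _) (cong (L +_) (sym (*-suc T (x + y))))))

-- Nested doublings let `run-digit` peel off the two low zeros one at a time.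
shift : ℕ → ℕ → ℕ
shift S x = 2 * (2 * (S * x))

-- The same four pairs with A = P_j, P_k = L + T (1 + 2 ε + 4 q), P_i = L + 4 T S (1 + 2 ε + 4 r), S = 2^m, where
-- f = S − 1 − q is the digitwise complement of q.
borrow : ∀ n m {T} L A e q f r g ε {κ} → 2 ^ n ≡ T → 2 ^ m ≡ suc (q + f) →
  L < T → A < T → e < T → A + e ≡ L + T →
  let b = L + T * shift (suc (q + f)) (2 * (2 * suc (r + g))) in
  n + (2 + (m + 2)) ≤ b →
  OddState (run n 0F A e) → OddState (run m (step 0F ε (not ε)) q f) →
  colour A b ≡ κ →
  colour (L + T * withLowBits ε q) b ≡ κ →
  colour (L + T * shift (suc (q + f)) (withLowBits ε r)) b ≡ κ →
  colour (A + T * (1 + 2 * (digit (not ε) + 2 * (f + suc (q + f) * (0 + 2 * (digit ε + 2 * r)))))) b ≢ κ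
borrow n m {T} L A e q f r g ε {κ} nT mS L< A< e< Ae nm≤ odd₁ odd₂ cj ck ci cmix =
  swapped-block-borrow-≢ (subst OddState κ₁ odd₁) ε m t q f r g κ₂ κ₃ κ₄
  where
  S = suc (q + f)
  b = L + T * shift S (2 * (2 * suc (r + g)))
  t = b ∸ (n + (2 + (m + 2)))
  fuel : ℕ
  -- Digits in order: `n` of the low block, two for 1 and `ε` of P_k, `m` for `q` and `f`, two for 1
  -- and `ε` of P_i, then the rest.
  fuel = n + suc (suc (m + suc (suc t)))
  b≡ : b ≡ fuel
  b≡ = trans (sym (m+[n∸m]≡n nm≤)) (lemma n m t)
    where
    lemma : ∀ n m t → n + (2 + (m + 2)) + t ≡ n + (2 + (m + (2 + t)))
    lemma = solve-∀
  q< : q < S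
  q< = s≤s (m≤m+n q f)
  f< : f < S
  f< = s≤s (m≤n+m f q)
  decode : ∀ {a} x y → a ≡ x → x + y ≡ b → colour a b ≡ κ → run fuel 0F x y ≡ κ
  decode x y refl xy c = trans (sym (colour-run fuel b≡ xy)) c
  κ₁ : run n 0F A e ≡ κ
  κ₁ = trans (sym (run-final n _ nT A< e< odd₁))
    (decode (A + T * 0) (e + T * D) (pad₀ A T) (carry-sum A e T L 0 D Ae (lemma q f r g)) cj)
    where
    -- The high part of P_l minus the unit lent to the low block.
    D = 3 + 4 * ((q + f) + S * (3 + 4 * (r + g)))
    lemma : ∀ q f r g → suc (3 + 4 * ((q + f) + suc (q + f) * (3 + 4 * (r + g))))
                      ≡ 2 * (2 * (suc (q + f) * (2 * (2 * suc (r + g)))))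
    lemma = solve-∀
  κ₂ : run m (step 0F ε (not ε)) q f ≡ κ
  κ₂ = trans (sym
    (trans (run-skip n _ nT L<)
    (trans (run-digit true true (digit ε + 2 * (q + S * 0))
                      (digit (not ε) + 2 * (f + S * (3 + 4 * (r + g)))))
    (trans (run-digit ε (not ε) (q + S * 0) (f + S * (3 + 4 * (r + g))))
           (run-final m _ mS q< f< odd₂)))))
    (decode _ (T * (1 + 2 * (digit (not ε) + 2 * (f + S * (3 + 4 * (r + g))))))
            (cong (λ x → L + T * withLowBits ε x) (pad₀ q S)) (lemma ε L T q f r g) ck)
    where
    lemma : ∀ ε L T q f r g →
      L + T * (1 + 2 * (digit ε + 2 * (q + suc (q + f) * 0)))
      + T * (1 + 2 * (digit (not ε) + 2 * (f + suc (q + f) * (3 + 4 * (r + g)))))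
      ≡ L + T * (2 * (2 * (suc (q + f) * (2 * (2 * suc (r + g))))))
    lemma true  = solve-∀
    lemma false = solve-∀
  κ₃ : run t (step 0F ε (not ε)) r g ≡ κ
  κ₃ = trans (sym
    (trans (run-skip n _ nT L<)
    (trans (run-digit false false (2 * (S * withLowBits ε r))
                      (2 * (S * (1 + 2 * (digit (not ε) + 2 * g)))))
    (trans (run-digit false false (S * withLowBits ε r) (S * (1 + 2 * (digit (not ε) + 2 * g))))
    (trans (run-skip m _ mS z<s)
    (trans (run-digit true true (digit ε + 2 * r) (digit (not ε) + 2 * g))
           (run-digit ε (not ε) r g)))))))
    (decode _ (T * shift S (1 + 2 * (digit (not ε) + 2 * g))) refl (lemma ε L T S r g) ci)
    where
    lemma : ∀ ε L T S r g →
      L + T * (2 * (2 * (S * (1 + 2 * (digit ε + 2 * r)))))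
      + T * (2 * (2 * (S * (1 + 2 * (digit (not ε) + 2 * g)))))
      ≡ L + T * (2 * (2 * (S * (2 * (2 * suc (r + g))))))
    lemma true  = solve-∀
    lemma false = solve-∀
  κ₄ : run t (step (step (run m (step (step κ true false) (not ε) ε) f q) false true) ε (not ε)) r g ≡ κ
  κ₄ = trans (sym
    (trans (run-from n _ nT A< e< κ₁)
    (trans (run-digit true false (digit (not ε) + 2 * (f + S * X)) (digit ε + 2 * (q + S * Y)))
    (trans (run-digit (not ε) ε (f + S * X) (q + S * Y))
    (trans (run-++ m _ mS f< q<)
    (trans (run-digit false true (digit ε + 2 * r) (digit (not ε) + 2 * g))
           (run-digit ε (not ε) r g)))))))
    (decode _ (e + T * (0 + 2 * (digit ε + 2 * (q + S * Y)))) refl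
            (carry-sum A e T L (1 + 2 * (digit (not ε) + 2 * (f + S * X)))
              (0 + 2 * (digit ε + 2 * (q + S * Y))) Ae (lemma ε q f r g)) cmix)
    where
    -- The lowest one of P_i - L is borrowed in P_i - P_k, leaving 0 at that place.
    X = 0 + 2 * (digit ε + 2 * r)
    Y = 1 + 2 * (digit (not ε) + 2 * g)
    lemma : ∀ ε q f r g →
      suc ((1 + 2 * (digit (not ε) + 2 * (f + suc (q + f) * (0 + 2 * (digit ε + 2 * r)))))
      + (0 + 2 * (digit ε + 2 * (q + suc (q + f) * (1 + 2 * (digit (not ε) + 2 * g))))))
      ≡ 2 * (2 * (suc (q + f) * (2 * (2 * suc (r + g)))))
    lemma true  = solve-∀
    lemma false = solve-∀

-- Powers of two and odd parts.

n<2^n : ∀ n → n < 2 ^ n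
n<2^n zero    = z<s
n<2^n (suc n) = subst (suc (suc n) ≤_) (cong (2 ^ n +_) (sym (+-identityʳ (2 ^ n))))
  (+-mono-≤ (m^n>0 2 n) (n<2^n n))

low-bit : ∀ h → ∃ λ ε → ∃ λ r → suc (2 * h) ≡ withLowBits ε r
low-bit h with bit-half h
... | inj₁ (_ , h≡) = false , ⌊ h /2⌋ , cong (suc ∘ (2 *_)) h≡
... | inj₂ (_ , h≡) = true  , ⌊ h /2⌋ , cong (suc ∘ (2 *_)) h≡

-- The bound `b` makes the repeated halving of `q` structurally recursive.
odd-part : ∀ b q → q ≤ b → q ≢ 0 → ∃ λ v → ∃ λ ε → ∃ λ r → q ≡ 2 ^ v * withLowBits ε r
odd-part b       zero    _  q≢0 = ⊥-elim (q≢0 refl)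
odd-part (suc b) (suc q) q≤ q≢0 with bit-half (suc q)
... | inj₂ (_ , q≡) with low-bit ⌊ suc q /2⌋
...   | ε , r , h≡ = 0 , ε , r , trans q≡ (trans h≡ (sym (*-identityˡ _)))
odd-part (suc b) (suc q) q≤ q≢0 | inj₁ (_ , q≡)
  with odd-part b ⌊ suc q /2⌋ (s≤s⁻¹ (≤-trans (⌊n/2⌋<n q) q≤)) (λ h≡0 → q≢0 (trans q≡ (cong (2 *_) h≡0)))
... | v , ε , r , h≡ = suc v , ε , r , trans q≡ (trans (cong (2 *_) h≡) (sym (*-assoc 2 (2 ^ v) _)))

-- Cluster points, and the limit that is not a natural number.

module Clusters
  (P : ℕ → ℕ) (P-suc : ∀ n → P n < P (suc n)) {κ : Fin 4}
  -- The equation encodes a = P_j + P_i - P_k without truncated subtraction; j = k = i gives the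
  -- pair (P_i , P_l).
  (mono : ∀ {j k i l a} → j ≤ k → k ≤ i → i < l → a + P k ≡ P j + P i → colour a (P l) ≡ κ)
  where

  P-< : ∀ {m n} → m < n → P m < P n
  P-< {m} {suc n} (s≤s m≤n) with m≤n⇒m<n∨m≡n m≤n
  ... | inj₁ m<n  = <-trans (P-< m<n) (P-suc n)
  ... | inj₂ refl = P-suc n

  n≤P : ∀ n → n ≤ P n
  n≤P zero    = z≤n
  n≤P (suc n) = ≤-trans (s≤s (n≤P n)) (P-suc n)

  -- Up to double negation: P m ≡ r (mod 2^n), with P m ≥ r, for infinitely many m.
  Cluster : ℕ → ℕ → Set
  Cluster n r = ∀ m → ¬ ¬ (∃ λ m′ → m ≤ m′ × ∃ λ q → P m′ ≡ r + 2 ^ n * q)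

  cluster-0 : Cluster 0 0
  cluster-0 m k = k (m , ≤-refl , P m , sym (+-identityʳ (P m)))

  -- If the next digit 1 stops occurring after `m₀`, every later member of the cluster has next
  -- digit 0.
  cluster-suc : ∀ n r → Cluster n r → ¬ Cluster (suc n) (r + 2 ^ n) → Cluster (suc n) r
  cluster-suc n r c ¬c m k = ¬c λ m₀ k₀ → c (m ⊔ m₀) λ
    (m′ , m≤ , q , eq) → case m′ (m⊔n≤o⇒m≤o m m₀ m≤) (m⊔n≤o⇒n≤o m m₀ m≤) q eq k₀ (bit-half q)
    where
    even : ∀ r T h → r + T * (2 * h) ≡ r + 2 * T * h
    even = solve-∀
    odd : ∀ r T h → r + T * suc (2 * h) ≡ r + T + 2 * T * h
    odd = solve-∀
    case : ∀ {m₀} m′ → m ≤ m′ → m₀ ≤ m′ → ∀ q → P m′ ≡ r + 2 ^ n * q →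
           ¬ (∃ λ m′ → m₀ ≤ m′ × ∃ λ q → P m′ ≡ r + 2 ^ n + 2 ^ suc n * q) →
           (bit q ≡ false × q ≡ 2 * ⌊ q /2⌋) ⊎ (bit q ≡ true × q ≡ suc (2 * ⌊ q /2⌋)) → ⊥
    case m′ m≤ m₀≤ q eq k₀ (inj₁ (_ , q≡)) = k (m′ , m≤ , ⌊ q /2⌋ ,
      trans eq (trans (cong (λ x → r + 2 ^ n * x) q≡) (even r (2 ^ n) ⌊ q /2⌋)))
    case m′ m≤ m₀≤ q eq k₀ (inj₂ (_ , q≡)) = k₀ (m′ , m₀≤ , ⌊ q /2⌋ ,
      trans eq (trans (cong (λ x → r + 2 ^ n * x) q≡) (odd r (2 ^ n) ⌊ q /2⌋)))

  -- Infinitely many P_m agree with `L` modulo each high power of two, so `L` itself is a 2-adic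
  -- cluster point.
  NaturalLimit : Set
  NaturalLimit = ∃ λ n → ∃ λ L → ∀ t → Cluster (n + t) L

  -- If only zero digits could follow, r itself would be a natural cluster point.
  next-one : ¬ NaturalLimit → ∀ n r → Cluster n r →
             ¬ ¬ (∃ λ t → Cluster (suc (n + t)) (r + 2 ^ (n + t)))
  next-one ¬nat n r c k = ¬nat (n , r , zeros)
    where
    zeros : ∀ t → Cluster (n + t) r
    zeros zero    = subst (λ x → Cluster x r) (sym (+-identityʳ n)) c
    zeros (suc t) = subst (λ x → Cluster x r) (sym (+-suc n t))
      (cluster-suc (n + t) r (zeros t) λ c′ → k (t , c′))

  -- Each use of `next-one` puts a new top digit 1 on `c`, so `B` uses bring it to at least `B`.
  grow : ¬ NaturalLimit → ∀ n r → Cluster n r → ∀ B →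
         ¬ ¬ (∃ λ t → ∃ λ c → B ≤ c × c < 2 ^ t × Cluster (n + t) (r + 2 ^ n * c))
  grow ¬nat n r cl zero k = k (0 , 0 , z≤n , z<s ,
    subst₂ Cluster (sym (+-identityʳ n)) (pad₀ r (2 ^ n)) cl)
  grow ¬nat n r cl (suc B) k = grow ¬nat n r cl B λ where
    (t , c , B≤ , c< , cl′) → next-one ¬nat (n + t) (r + 2 ^ n * c) cl′ λ where
      (t′ , cl″) → k (suc (t + t′) , c + 2 ^ (t + t′) ,
        subst (_≤ c + 2 ^ (t + t′)) (+-comm B 1) (+-mono-≤ B≤ (m^n>0 2 (t + t′))) ,
        subst (c + 2 ^ (t + t′) <_) (cong (2 ^ (t + t′) +_) (sym (+-identityʳ _)))
          (+-monoˡ-< _ (<-≤-trans c< (^-monoʳ-≤ 2 (m≤m+n t t′)))) ,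
        subst₂ Cluster
          (trans (cong suc (+-assoc n t t′)) (sym (+-suc n (t + t′))))
          (trans (cong (λ x → r + 2 ^ n * c + x)
                   (trans (cong (2 ^_) (+-assoc n t t′)) (^-distribˡ-+-* 2 n (t + t′))))
            (trans (+-assoc r _ _) (cong (r +_) (sym (*-distribˡ-+ (2 ^ n) c _)))))
          cl″)

  natural-limit : ¬ ¬ NaturalLimit
  natural-limit ¬nat =
    -- The bound makes b₀ - P_0 at least 2^P_0, above all digits of P_0, so `run-top` applies;
    -- likewise below for c₀ - q.
    grow ¬nat 0 0 cluster-0 (P 0 + 2 ^ P 0) λ (n , b₀ , B≤ , b₀< , cl₀) →
    let cl₁ = subst (Cluster n) (+-identityʳ b₀) cl₀ in
    cl₁ 1 λ (k , 1≤k , q , Pk) →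
    grow ¬nat n b₀ cl₁ (q + 2 ^ q) λ (m , c₀ , B′≤ , c₀< , cl₂) →
    cl₂ (suc k) λ (i , k<i , r , Pi) →
    cl₂ (suc i ⊔ (n + m)) λ (l , l≥ , b₂ , Pl) →
    contra n b₀ B≤ b₀< k 1≤k q Pk m c₀ B′≤ c₀< i k<i r Pi l
      (m⊔n≤o⇒m≤o (suc i) (n + m) l≥) (m⊔n≤o⇒n≤o (suc i) (n + m) l≥) b₂ Pl
    where
    factor : ∀ n m b c x → b + 2 ^ n * c + 2 ^ (n + m) * x ≡ b + 2 ^ n * (c + 2 ^ m * x)
    factor n m b c x rewrite ^-distribˡ-+-* 2 n m = lemma b (2 ^ n) (2 ^ m) c x
      where
      lemma : ∀ b T S c x → b + T * c + T * S * x ≡ b + T * (c + S * x)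
      lemma = solve-∀
    contra : ∀ n b₀ → P 0 + 2 ^ P 0 ≤ b₀ → b₀ < 2 ^ n →
      ∀ k → 1 ≤ k → ∀ q → P k ≡ b₀ + 2 ^ n * q →
      ∀ m c₀ → q + 2 ^ q ≤ c₀ → c₀ < 2 ^ m →
      ∀ i → k < i → ∀ r → P i ≡ b₀ + 2 ^ n * c₀ + 2 ^ (n + m) * r →
      ∀ l → i < l → n + m ≤ l → ∀ b₂ → P l ≡ b₀ + 2 ^ n * c₀ + 2 ^ (n + m) * b₂ → ⊥
    contra n b₀ B≤ b₀< k 1≤k q Pk m c₀ B′≤ c₀< i k<i r Pi l i<l nm≤ b₂ Pl
      with m≤n⇒∃[o]m+o≡n (m+n≤o⇒m≤o (P 0) B≤) | m≤n⇒∃[o]m+o≡n (m+n≤o⇒m≤o q B′≤)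
         | m≤n⇒∃[o]m+o≡n {r} {b₂} (≮⇒≥ (λ b₂<r → <-asym (P-< i<l)
             (subst₂ _<_ (sym Pl) (sym Pi) (+-monoʳ-< _ (*-monoʳ-< (2 ^ (n + m)) {{m^n≢0 2 (n + m)}} b₂<r)))))
    ... | e , refl | f , refl | g , refl =
      no-borrow n m (P 0) e q f r g refl refl b₀< c₀<
        (≤-trans nm≤ (subst (l ≤_) Pl′ (n≤P l)))
        (run-top n (P 0) 0F (P 0) e (n<2^n (P 0)) (+-cancelˡ-≤ (P 0) _ _ B≤)
          (≤-<-trans (m≤n+m e (P 0)) b₀<))
        (run-top m q 0F q f (n<2^n q) (+-cancelˡ-≤ q _ _ B′≤) (≤-<-trans (m≤n+m f q) c₀<))
        (obs {0} {0} {0} ≤-refl ≤-refl (<-trans 1≤k (<-trans k<i i<l)) refl)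
        (obs {k} {k} {k} ≤-refl ≤-refl (<-trans k<i i<l) (cong (_+ P k) (sym Pk)))
        (obs {i} {i} {i} ≤-refl ≤-refl i<l (cong (_+ P i) (sym Pi′)))
        (obs {0} {k} {i} z≤n (<⇒≤ k<i) i<l
          (trans (cong ((P 0 + 2 ^ n * (f + 2 ^ m * r)) +_) Pk) (trans (lemma (P 0) e q f r (2 ^ n) (2 ^ m)) (cong (P 0 +_) (sym Pi′)))))
      where
      Pi′ = trans Pi (factor n m (P 0 + e) (q + f) r)
      Pl′ = trans Pl (factor n m (P 0 + e) (q + f) (r + g))
      obs : ∀ {j k i a} → j ≤ k → k ≤ i → i < l → a + P k ≡ P j + P i → colour a _ ≡ κ
      obs {a = a} j≤ k≤ i< eq = subst (λ b → colour a b ≡ κ) Pl′ (mono j≤ k≤ i< eq)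
      lemma : ∀ p e q f r T S → (p + T * (f + S * r)) + ((p + e) + T * q)
                              ≡ p + ((p + e) + T * ((q + f) + S * r))
      lemma = solve-∀

  -- Contradiction from a natural limit.

  module _ (L n₀ : ℕ) (limit : ∀ t → Cluster (n₀ + t) L) where

    Recurrent : Bool → Set
    Recurrent ε = ∀ N m → ¬ ¬ (∃ λ m′ → m ≤ m′ × ∃ λ u → N ≤ u × ∃ λ r →
                                P m′ ≡ L + 2 ^ u * withLowBits ε r)

    some-low-bits : ∀ N m → ¬ ¬ (∃ λ ε → ∃ λ m′ → m ≤ m′ × ∃ λ u → N ≤ u × ∃ λ r →
                                  P m′ ≡ L + 2 ^ u * withLowBits ε r)
    -- An index above `L` forces P_m′ > L, so the quotient is nonzero and has an odd part.
    some-low-bits N m k = limit N (m ⊔ suc L) λ (m′ , m≤ , q , eq) →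
      found m′ m≤ q eq (odd-part q q ≤-refl (q≢0 m′ m≤ q eq))
      where
      q≢0 : ∀ m′ → m ⊔ suc L ≤ m′ → ∀ q → P m′ ≡ L + 2 ^ (n₀ + N) * q → q ≢ 0
      q≢0 m′ m≤ _ eq refl = <-irrefl (sym (trans eq (sym (pad₀ L (2 ^ (n₀ + N))))))
        (≤-trans (m⊔n≤o⇒n≤o m (suc L) m≤) (n≤P m′))
      found : ∀ m′ → m ⊔ suc L ≤ m′ → ∀ q → P m′ ≡ L + 2 ^ (n₀ + N) * q →
              (∃ λ v → ∃ λ ε → ∃ λ r → q ≡ 2 ^ v * withLowBits ε r) → ⊥
      found m′ m≤ _ eq (v , ε , r , refl) = k (ε , m′ , m⊔n≤o⇒m≤o m (suc L) m≤ ,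
        n₀ + N + v , ≤-trans (m≤n+m N n₀) (m≤m+n (n₀ + N) v) , r ,
        trans eq (cong (L +_) (trans (sym (*-assoc (2 ^ (n₀ + N)) (2 ^ v) _))
          (cong (_* withLowBits ε r) (sym (^-distribˡ-+-* 2 (n₀ + N) v))))))

    -- Pigeonhole on two digits: if each failed past some bounds, `some-low-bits` past the larger
    -- ones would leave no digit.
    recurrent : ¬ ¬ ∃ Recurrent
    recurrent k = k (false , λ N m k₀ → k (true , λ N′ m′ k₁ →
      some-low-bits (N ⊔ N′) (m ⊔ m′) λ where
        (false , x , x≥ , u , u≥ , rest) →
          k₀ (x , m⊔n≤o⇒m≤o m m′ x≥ , u , m⊔n≤o⇒m≤o N N′ u≥ , rest)
        (true , x , x≥ , u , u≥ , rest) →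
          k₁ (x , m⊔n≤o⇒n≤o m m′ x≥ , u , m⊔n≤o⇒n≤o N N′ u≥ , rest)))

    -- This index gives P_j > L, which keeps e = L + 2^n - P_j below 2^n.
    j = suc L
    A = P j

    L<A : L < A
    L<A = n≤P j

    2^≤ : ∀ {m x} → suc x ≤ m → x + 2 ^ x < 2 ^ m
    2^≤ {m} {x} x<m = <-≤-trans (+-monoˡ-< (2 ^ x) (n<2^n x))
      (subst (_≤ 2 ^ m) (cong (2 ^ x +_) (+-identityʳ (2 ^ x))) (^-monoʳ-≤ 2 x<m))

    contra : ∀ ε k → suc j ≤ k → ∀ n → suc A ≤ n → ∀ q → P k ≡ L + 2 ^ n * withLowBits ε q →
      ∀ i → suc k ≤ i → ∀ m → suc q ≤ m → ∀ r → P i ≡ L + 2 ^ n * shift (2 ^ m) (withLowBits ε r) →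
      ∀ l → suc i ≤ l → n + (2 + (m + 2)) ≤ l →
      ∀ c → P l ≡ L + 2 ^ n * shift (2 ^ m) (2 * (2 * c)) → ⊥
    contra ε k j<k n A<n q Pk i k<i m q<m r Pi l i<l l≥ c Pl =
      finish (m≤n⇒∃[o]m+o≡n (≤-trans (<⇒≤ (2^≤ A<n)) (m≤n+m (2 ^ n) L))) (m≤n⇒∃[o]m+o≡n (2^≤ q<m)) (m≤n⇒∃[o]m+o≡n r<c)
      where
      r<c : r < c
      r<c = ≰⇒> λ c≤r → <⇒≱ (P-< i<l) (subst₂ _≤_ (sym Pl) (sym Pi)
        (+-monoʳ-≤ L (*-monoʳ-≤ (2 ^ n) (*-monoʳ-≤ 2 (*-monoʳ-≤ 2 (*-monoʳ-≤ (2 ^ m)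
          (m≤n⇒m≤1+n (*-monoʳ-≤ 2 (≤-trans (*-monoʳ-≤ 2 c≤r) (m≤n+m (2 * r) (digit ε)))))))))))
      finish : (∃ λ e₀ → A + 2 ^ A + e₀ ≡ L + 2 ^ n) → (∃ λ f₀ → suc (q + 2 ^ q) + f₀ ≡ 2 ^ m) →
               (∃ λ g → suc r + g ≡ c) → ⊥
      finish (e₀ , e≡) (f₀ , f≡) (g , refl) =
        borrow n m L A e q f r g ε refl S≡
          (<-trans L<A A<) A< e< A+e≡
          (≤-trans l≥ (subst (l ≤_) Pl′ (n≤P l)))
          (run-top n A 0F A e (n<2^n A) (m≤m+n (2 ^ A) e₀) e<)
          (run-top m q _ q f (n<2^n q) (m≤m+n (2 ^ q) f₀) (subst (f <_) (sym S≡) (s≤s (m≤n+m f q))))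
          (obs {j} {j} {j} ≤-refl ≤-refl (<-trans j<k (<-trans k<i i<l)) refl)
          (obs {k} {k} {k} ≤-refl ≤-refl (<-trans k<i i<l) (cong (_+ P k) (sym Pk)))
          (obs {i} {i} {i} ≤-refl ≤-refl i<l (cong (_+ P i) (sym Pi′)))
          (obs {j} {k} {i} (<⇒≤ j<k) (<⇒≤ k<i) i<l
            (trans (cong ((A + 2 ^ n * (1 + 2 * (digit (not ε) + 2 * (f + suc (q + f) * (0 + 2 * (digit ε + 2 * r)))))) +_) Pk)
            (trans (lemma ε A L (2 ^ n) q f r) (cong (A +_) (sym Pi′)))))
        where
        -- The summands `2 ^ A` and `2 ^ q` place ones above all digits of `A` and `q`, as `run-top`
        -- requires.
        e = 2 ^ A + e₀
        f = 2 ^ q + f₀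
        A+e≡ : A + e ≡ L + 2 ^ n
        A+e≡ = trans (sym (+-assoc A _ e₀)) e≡
        S≡ : 2 ^ m ≡ suc (q + f)
        S≡ = trans (sym f≡) (cong suc (+-assoc q _ f₀))
        A< : A < 2 ^ n
        A< = ≤-<-trans (m≤m+n A (2 ^ A)) (2^≤ A<n)
        e< : e < 2 ^ n
        e< = +-cancelˡ-< A e (2 ^ n)
          (subst (_< A + 2 ^ n) (sym A+e≡) (+-monoˡ-< (2 ^ n) L<A))
        Pi′ : P i ≡ L + 2 ^ n * shift (suc (q + f)) (withLowBits ε r)
        Pi′ = subst (λ S → P i ≡ L + 2 ^ n * shift S (withLowBits ε r)) S≡ Pi
        Pl′ : P l ≡ L + 2 ^ n * shift (suc (q + f)) (2 * (2 * suc (r + g)))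
        Pl′ = subst (λ S → P l ≡ L + 2 ^ n * shift S (2 * (2 * suc (r + g)))) S≡ Pl
        obs : ∀ {j k i a} → j ≤ k → k ≤ i → i < l → a + P k ≡ P j + P i → colour a _ ≡ κ
        obs {a = a} j≤ k≤ i< eq = subst (λ b → colour a b ≡ κ) Pl′ (mono j≤ k≤ i< eq)
        lemma : ∀ ε A L T q f r →
          A + T * (1 + 2 * (digit (not ε) + 2 * (f + suc (q + f) * (0 + 2 * (digit ε + 2 * r)))))
          + (L + T * (1 + 2 * (digit ε + 2 * q)))
          ≡ A + (L + T * (2 * (2 * (suc (q + f) * (1 + 2 * (digit ε + 2 * r))))))
        lemma true  = solve-∀
        lemma false = solve-∀

    2^-shift : ∀ n m x → 2 ^ (n + 2 + m) * x ≡ 2 ^ n * shift (2 ^ m) x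
    2^-shift n m x rewrite ^-distribˡ-+-* 2 (n + 2) m | ^-distribˡ-+-* 2 n 2 = lemma (2 ^ n) (2 ^ m) x
      where
      lemma : ∀ T S x → T * 4 * S * x ≡ T * (2 * (2 * (S * x)))
      lemma = solve-∀

    ¬limit : ⊥
    ¬limit = recurrent λ (ε , rec) →
      rec (suc A) (suc j) λ (k , j<k , n , A<n , q , Pk) →
      -- Writing u = n + 2 + m, this gives m > q, hence room below 2^m for q + 2^q.
      rec (n + 2 + suc q) (suc k) λ (i , k<i , u , u≥ , r , Pi) →
      go ε k j<k n A<n q Pk i k<i u u≥ (m≤n⇒∃[o]m+o≡n (m+n≤o⇒m≤o (n + 2) u≥)) r Pi
      where
      go : ∀ ε k → suc j ≤ k → ∀ n → suc A ≤ n → ∀ q → P k ≡ L + 2 ^ n * withLowBits ε q →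
        ∀ i → suc k ≤ i → ∀ u → n + 2 + suc q ≤ u → (∃ λ m → n + 2 + m ≡ u) →
        ∀ r → P i ≡ L + 2 ^ u * withLowBits ε r → ⊥
      go ε k j<k n A<n q Pk i k<i _ u≥ (m , refl) r Pi =
        -- The last 2 makes P_l - L vanish also at the two places where P_i - L has its digits 1 and
        -- `ε`.
        limit (n + 2 + m + 2) (suc i ⊔ (n + (2 + (m + 2)))) λ (l , l≥ , c , Pl) →
        contra ε k j<k n A<n q Pk i k<i m (+-cancelˡ-≤ (n + 2) _ _ u≥) r
          (trans Pi (cong (L +_) (2^-shift n m (withLowBits ε r))))
          l (m⊔n≤o⇒m≤o (suc i) (n + (2 + (m + 2))) l≥) (m⊔n≤o⇒n≤o (suc i) (n + (2 + (m + 2))) l≥) (2 ^ n₀ * c)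
          (trans Pl (cong (L +_) (trans (reassoc c) (2^-shift n m _))))
        where
        reassoc : ∀ c → 2 ^ (n₀ + (n + 2 + m + 2)) * c ≡ 2 ^ (n + 2 + m) * (2 * (2 * (2 ^ n₀ * c)))
        reassoc c rewrite ^-distribˡ-+-* 2 n₀ (n + 2 + m + 2) | ^-distribˡ-+-* 2 (n + 2 + m) 2 =
          lemma (2 ^ n₀) (2 ^ (n + 2 + m)) c
          where
          lemma : ∀ x y c → x * (y * 4) * c ≡ y * (2 * (2 * (x * c)))
          lemma = solve-∀

  contradiction : ⊥
  contradiction = natural-limit λ (n₀ , L , limit) → ¬limit L n₀ limit

-- Index sets realising the four pairs.

-- interval m t = [m + 1, …, m + t]
interval : ℕ → ℕ → List ℕ
interval m zero    = []
interval m (suc t) = suc m ∷ interval (suc m) t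

sum-interval : ∀ y m t → sumTo y m + sum (map y (interval m t)) ≡ sumTo y (m + t)
sum-interval y m zero    = trans (+-identityʳ _) (cong (sumTo y) (sym (+-identityʳ m)))
sum-interval y m (suc t) = trans (sym (+-assoc (sumTo y m) _ _))
  (trans (sum-interval y (suc m) t) (cong (sumTo y) (sym (+-suc m t))))

interval-≥ : ∀ m t → All (suc m ≤_) (interval m t)
interval-≥ m zero    = []
interval-≥ m (suc t) = ≤-refl ∷ All.map <⇒≤ (interval-≥ (suc m) t)

interval-≤ : ∀ m t → All (_≤ m + t) (interval m t)
interval-≤ m zero    = []
interval-≤ m (suc t) = m<m+n m z<s ∷
  subst (λ x → All (_≤ x) (interval (suc m) t)) (sym (+-suc m t)) (interval-≤ (suc m) t)

∷-linked : ∀ {x xs} → All (x <_) xs → Linked _<_ xs → Linked _<_ (x ∷ xs)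
∷-linked []        []  = [-]
∷-linked (x< ∷ _) ls  = x< ∷ ls

interval-++-linked : ∀ m t {xs} → All (m + t <_) xs → Linked _<_ xs → Linked _<_ (interval m t ++ xs)
interval-++-linked m zero    _  ls = ls
interval-++-linked m (suc t) {xs} ps ls = ∷-linked
  (All.++⁺ (interval-≥ (suc m) t) (All.map (≤-<-trans (s≤s (m≤m+n m t))) ps′))
  (interval-++-linked (suc m) t ps′ ls)
  where
  ps′ : All (suc (m + t) <_) xs
  ps′ = subst (λ x → All (x <_) xs) (+-suc m t) ps

-- With y_1, the indices 2, ..., j + 1 sum to P_j and k + 2, ..., i + 1 add P_i - P_k; j ≤ k keeps
-- them increasing.
mono-combination : ∀ {y} {κ : Fin 4} → Monochromatic colour y κ → ∀ {j k i l a} →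
  j ≤ k → k ≤ i → i < l → a + sumTo y (suc k) ≡ sumTo y (suc j) + sumTo y (suc i) →
  colour a (sumTo y (suc l)) ≡ κ
mono-combination {y} {κ} mc {j} {k} {i} {l} {a} j≤k k≤i i<l eq =
  subst (λ x → colour x (sumTo y (suc l)) ≡ κ) value (mc ks (suc l) (linked , ≥2 , <l , s≤s (≤-<-trans z≤n i<l)))
  where
  xs = interval 1 j
  zs = interval (suc k) (i ∸ k)
  ks = xs ++ zs
  linked : Linked _<_ ks
  linked = interval-++-linked 1 j (All.map (≤-<-trans (s≤s j≤k)) (interval-≥ (suc k) (i ∸ k)))
    (subst (Linked _<_) (++-identityʳ zs) (interval-++-linked (suc k) (i ∸ k) [] []))
  ≥2 : All (2 ≤_) ks
  ≥2 = All.++⁺ (interval-≥ 1 j) (All.map (≤-trans (s≤s (s≤s z≤n))) (interval-≥ (suc k) (i ∸ k)))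
  <l : All (_< suc l) ks
  <l = All.++⁺
    (All.map (λ p → s≤s (≤-trans p (≤-trans (s≤s (≤-trans j≤k k≤i)) i<l))) (interval-≤ 1 j))
    (All.map (λ p → s≤s (≤-trans p (subst (λ x → suc x ≤ l) (sym (m+[n∸m]≡n k≤i)) i<l))) (interval-≤ (suc k) (i ∸ k)))
  value : y 1 + sum (map y ks) ≡ a
  value = +-cancelʳ-≡ (sumTo y (suc k)) _ a (begin
    y 1 + sum (map y ks) + sumTo y (suc k)
      ≡⟨ cong (λ x → y 1 + x + sumTo y (suc k)) (trans (cong sum (map-++ y xs zs)) (sum-++ (map y xs) (map y zs))) ⟩
    y 1 + (sum (map y xs) + sum (map y zs)) + sumTo y (suc k)
      ≡⟨ regroup (y 1) (sum (map y xs)) (sum (map y zs)) (sumTo y (suc k)) ⟩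
    (y 1 + sum (map y xs)) + (sumTo y (suc k) + sum (map y zs))
      ≡⟨ cong₂ _+_ (sum-interval y 1 j) (trans (sum-interval y (suc k) (i ∸ k)) (cong (sumTo y ∘ suc) (m+[n∸m]≡n k≤i))) ⟩
    sumTo y (suc j) + sumTo y (suc i)
      ≡⟨ sym eq ⟩
    a + sumTo y (suc k) ∎)
    where
    open ≡-Reasoning
    regroup : ∀ u v w x → u + (v + w) + x ≡ (u + v) + (x + w)
    regroup = solve-∀

theorem4 : Σ ℕ λ r → Σ (ℕ → ℕ → Fin r) λ c →
    ¬ (Σ (ℕ → ℕ) λ y → PositiveSeq y × Σ (Fin r) λ κ → Monochromatic c y κ)
theorem4 = 4 , colour , λ (y , pos , κ , mc) →
  -- The shift makes P_0 = y_1, the term present in every first coordinate.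
  Clusters.contradiction (λ n → sumTo y (suc n))
    (λ n → m<m+n (sumTo y (suc n)) (pos (suc (suc n)) (s≤s z≤n)))
    (mono-combination mc)
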